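{- Let $n,m_1,m_2$ be nonnegative integers. Let $C_1(m_1,m_2,n)$ be the number of partitions of $n$ into parts congruent to $0,1,3,$ or $5\pmod 6$ with exactly $m_1$ parts congruent to $1\pmod 6$ and exactly $m_2$ parts congruent to $5\pmod 6$. Let $C_2(m_1,m_2,n)$ be the number of partitions of $n$ satisfying: (a) if two adjacent parts differ by exactly $1$, the smaller is not $\equiv1\pmod3$; (b) if two adjacent parts differ by exactly $2$, the smaller is $\equiv2\pmod3$; (c) no part equals $2$; (d) there are exactly $m_1$ parts congruent to $1\pmod 3$ and exactly $m_2$ parts congruent to $2\pmod 3$. Then $C_1(m_1,m_2,n)=C_2(m_1,m_2,n)$.
   Context: Partitions are written in nonincreasing order; "adjacent parts" means $\lambda_j$ and $\lambda_{j+1}$ in that ordering. Numbers of parts in a residue class are counted with multiplicity. -}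

module Defs where

open import Data.List using (List; []; _∷_; map; concatMap; applyUpTo; filter; length)
open import Data.Nat.ListAction using (sum)
open import Data.List.Membership.Propositional using (_∈_; _∉_; find)
open import Data.List.Membership.Propositional.Properties using (∈-applyUpTo⁺; ∈-applyUpTo⁻; ∈-map⁺; ∈-map⁻; ∈-concatMap⁺; ∈-concatMap⁻)
open import Data.List.Relation.Unary.All using (All; []; _∷_; all?)
import Data.List.Relation.Unary.All as All
open import Data.List.Relation.Unary.AllPairs using ([]; _∷_)
import Data.List.Relation.Unary.AllPairs.Properties as AllPairs
import Data.List.Relation.Unary.All.Properties as All
open import Data.List.Relation.Unary.Any using (here)
import Data.List.Relation.Unary.Any as Any
open import Data.List.Relation.Unary.Linked using (Linked; []; [-]; _∷_; linked?)
import Data.List.Relation.Unary.Linked as Linked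
open import Data.List.Relation.Unary.Unique.Propositional using (Unique)
import Data.List.Relation.Unary.Unique.Propositional.Properties as Unique
open import Data.List.Properties using (∷-injectiveˡ; ∷-injectiveʳ)
open import Data.Nat using (ℕ; zero; suc; _+_; _∸_; _%_; _⊓_; _≤_; _≥_; _<_; z≤n; s≤s; _≟_; NonZero)
open import Data.List.Membership.DecPropositional _≟_ using (_∈?_; _∉?_)
open import Data.Nat.Properties using (≤-refl; ≤-trans; m⊓n≤m; m⊓n≤n; ⊓-glb; m≤m+n; m≤n+m; m+[n∸m]≡n; m+n∸m≡n; m∸n≤m; <⇒≢; suc-injective)
open import Data.Product using (_×_; _,_; proj₁; proj₂)
open import Function using (_∘_; _⇔_; mk⇔)
open import Relation.Binary.PropositionalEquality using (_≡_; _≢_; refl; sym; trans; cong; subst)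
open import Relation.Nullary using (¬?; _×-dec_; _→-dec_)
open import Relation.Unary using (Decidable)

record IsPartition (n : ℕ) (ps : List ℕ) : Set where
  constructor isPartition
  field
    positive      : All (0 <_) ps
    nonincreasing : Linked _≥_ ps
    sum≡n         : sum ps ≡ n

-- partitionsUpTo ℓ k n lists the partitions of n with at most ℓ parts, each
-- at most k.  The largest part a of a partition of suc n ranges over
-- 1, …, k ⊓ suc n.
partitionsUpTo : ℕ → ℕ → ℕ → List (List ℕ)
partitionsUpTo ℓ       k zero    = [] ∷ []
partitionsUpTo zero    k (suc n) = []
partitionsUpTo (suc ℓ) k (suc n) =
  concatMap (λ a → map (a ∷_) (partitionsUpTo ℓ a (suc n ∸ a)))
            (applyUpTo suc (k ⊓ suc n))

-- A partition of n has at most n parts, each at most n, so this list contains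
-- every partition of n; ∈-partitions and partitions-unique below show that it
-- contains nothing else and has no repetitions.
partitions : ℕ → List (List ℕ)
partitions n = partitionsUpTo n n n

numParts : (r d : ℕ) .{{_ : NonZero d}} → List ℕ → ℕ
numParts r d ps = length (filter (λ p → p % d ≟ r) ps)

Class₁ : (m₁ m₂ : ℕ) → List ℕ → Set
Class₁ m₁ m₂ ps =
    All (λ p → p % 6 ∈ 0 ∷ 1 ∷ 3 ∷ 5 ∷ []) ps
  × numParts 1 6 ps ≡ m₁
  × numParts 5 6 ps ≡ m₂

-- Here a is the larger and b the smaller of two adjacent parts.
Gap : ℕ → ℕ → Set
Gap a b = (a ∸ b ≡ 1 → b % 3 ≢ 1) × (a ∸ b ≡ 2 → b % 3 ≡ 2)

Class₂ : (m₁ m₂ : ℕ) → List ℕ → Set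
Class₂ m₁ m₂ ps =
    Linked Gap ps
  × 2 ∉ ps
  × numParts 1 3 ps ≡ m₁
  × numParts 2 3 ps ≡ m₂

class₁? : ∀ m₁ m₂ → Decidable (Class₁ m₁ m₂)
class₁? m₁ m₂ ps =
  all? (λ p → (p % 6) ∈? (0 ∷ 1 ∷ 3 ∷ 5 ∷ [])) ps
  ×-dec (numParts 1 6 ps ≟ m₁) ×-dec (numParts 5 6 ps ≟ m₂)

class₂? : ∀ m₁ m₂ → Decidable (Class₂ m₁ m₂)
class₂? m₁ m₂ ps =
  linked? (λ a b → ((a ∸ b ≟ 1) →-dec ¬? (b % 3 ≟ 1))
                   ×-dec ((a ∸ b ≟ 2) →-dec (b % 3 ≟ 2))) ps
  ×-dec (2 ∉? ps)
  ×-dec (numParts 1 3 ps ≟ m₁) ×-dec (numParts 2 3 ps ≟ m₂)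

C₁ : (m₁ m₂ n : ℕ) → ℕ
C₁ m₁ m₂ n = length (filter (class₁? m₁ m₂) (partitions n))

C₂ : (m₁ m₂ n : ℕ) → ℕ
C₂ m₁ m₂ n = length (filter (class₂? m₁ m₂) (partitions n))

private
  sound : ∀ ℓ k n {ps} → ps ∈ partitionsUpTo ℓ k n →
          IsPartition n ps × All (_≤ k) ps
  sound zero    k zero (here refl) = isPartition [] [] refl , []
  sound (suc ℓ) k zero (here refl) = isPartition [] [] refl , []
  sound (suc ℓ) k (suc n) ps∈
    with a , a∈ , ps∈a ← find (∈-concatMap⁻ (λ a → map (a ∷_) (partitionsUpTo ℓ a (suc n ∸ a)))
                                 {xs = applyUpTo suc (k ⊓ suc n)} ps∈)
    with qs , qs∈ , refl ← ∈-map⁻ (a ∷_) ps∈a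
    with i , i< , refl ← ∈-applyUpTo⁻ suc {n = k ⊓ suc n} a∈
    with isPartition pos dec s , qs≤ ← sound ℓ (suc i) (n ∸ i) qs∈
    = isPartition (s≤s z≤n ∷ pos) (link qs≤ dec)
        (trans (cong (suc i +_) s) (m+[n∸m]≡n (≤-trans i< (m⊓n≤n k (suc n)))))
    , a≤k ∷ All.map (λ q≤a → ≤-trans q≤a a≤k) qs≤
    where
    a≤k : suc i ≤ k
    a≤k = ≤-trans i< (m⊓n≤m k (suc n))
    link : ∀ {a qs} → All (_≤ a) qs → Linked _≥_ qs → Linked _≥_ (a ∷ qs)
    link []      _ = [-]
    link (p ∷ _) l = p ∷ l

  complete : ∀ ℓ k n {ps} → n ≤ ℓ → IsPartition n ps → All (_≤ k) ps →
             ps ∈ partitionsUpTo ℓ k n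
  complete ℓ       k zero    {[]}         _ _ _ = here refl
  complete ℓ       k zero    {zero ∷ _}  _ (isPartition (() ∷ _) _ _) _
  complete ℓ       k zero    {suc _ ∷ _} _ (isPartition _ _ ()) _
  complete ℓ       k (suc n) {[]}        _ (isPartition _ _ ()) _
  complete ℓ       k (suc n) {zero ∷ _}  _ (isPartition (() ∷ _) _ _) _
  complete (suc ℓ) k (suc n) {suc i ∷ qs} (s≤s n≤ℓ) (isPartition (_ ∷ pos) dec s) (a≤k ∷ _) =
    ∈-concatMap⁺ (λ a → map (a ∷_) (partitionsUpTo ℓ a (suc n ∸ a)))
      (Any.map (λ { refl → ∈-map⁺ (suc i ∷_) qs∈ })
               (∈-applyUpTo⁺ suc (⊓-glb a≤k a≤n)))
    where
    a≤n : suc i ≤ suc n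
    a≤n = subst (suc i ≤_) s (m≤m+n (suc i) (sum qs))
    bound : ∀ {a qs} → Linked _≥_ (a ∷ qs) → All (_≤ a) qs
    bound [-]     = []
    bound (p ∷ l) = p ∷ All.map (λ r≤b → ≤-trans r≤b p) (bound l)
    qs∈ : qs ∈ partitionsUpTo ℓ (suc i) (n ∸ i)
    qs∈ = complete ℓ (suc i) (n ∸ i) (≤-trans (m∸n≤m n i) n≤ℓ)
            (isPartition pos (Linked.tail dec)
              (trans (sym (m+n∸m≡n i (sum qs))) (cong (_∸ i) (suc-injective s))))
            (bound dec)

  unique : ∀ ℓ k n → Unique (partitionsUpTo ℓ k n)
  unique zero    k zero    = [] ∷ []
  unique (suc ℓ) k zero    = [] ∷ []
  unique zero    k (suc n) = []
  unique (suc ℓ) k (suc n) =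
    Unique.concat⁺
      (All.map⁺ (All.applyUpTo⁺₂ suc (k ⊓ suc n) λ i →
        Unique.map⁺ ∷-injectiveʳ (unique ℓ (suc i) (n ∸ i))))
      (AllPairs.map⁺ (AllPairs.applyUpTo⁺₁ suc (k ⊓ suc n) λ i<j _ (p , q) →
        let _ , _ , e₁ = ∈-map⁻ _ p
            _ , _ , e₂ = ∈-map⁻ _ q
        in <⇒≢ i<j (suc-injective (∷-injectiveˡ (trans (sym e₁) e₂)))))

∈-partitions : ∀ n ps → ps ∈ partitions n ⇔ IsPartition n ps
∈-partitions n ps = mk⇔ (proj₁ ∘ sound n n n) λ p →
  complete n n n ≤-refl p (subst (λ s → All (_≤ s) ps) (IsPartition.sum≡n p) (≤sum ps))
  where
  ≤sum : ∀ qs → All (_≤ sum qs) qs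
  ≤sum []       = []
  ≤sum (q ∷ qs) = m≤m+n q (sum qs) ∷
    All.map (λ r≤s → ≤-trans r≤s (m≤n+m (sum qs) q)) (≤sum qs)

partitions-unique : ∀ n → Unique (partitions n)
partitions-unique n = unique n n n

{-# OPTIONS --safe #-}
module Submission where

-- For d ∈ {3, 6} call a list of positive parts a d-chain if each part exceeds the
-- next (the last one exceeds 0) by δ + d j with j ≥ 0, where δ < 6 is a fixed function of
-- the residues mod 3 of the two parts.  The partitions counted by C₂ are the
-- 3-chains, and the 6-chains are the partitions into parts ≡ 0, 1, 5 (mod 6).
-- Termwise, a d-chain is uniquely μ + d ν with a minimal chain μ (all j = 0) and
-- a partition ν, whence
--   #(d-chains) = #(minimal chains) * p   (convolution, p scaled by d).
-- On the other side, extracting the multiples of d gives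
--   #(parts ≡ 1, 5 mod 6, or multiples of d) = #(parts ≡ 1, 5 mod 6) * p,
-- which for d = 3 is C₁ and for d = 6 counts the 6-chains again.  Cancelling p
-- for d = 6 equates minimal chains with partitions into parts ≡ 1, 5 (mod 6), and
-- convolving with p for d = 3 gives the theorem.

open import Defs
open import Data.List using (List; []; _∷_; _++_; map; filter; length; drop; upTo; cartesianProduct)
open import Data.Nat
open import Data.Nat.Properties
open import Data.List.Membership.DecPropositional _≟_ using (_∈?_)
open import Data.List.Membership.Propositional using (_∈_; _∉_)
open import Data.List.Membership.Propositional.Properties
  using (∈-map⁺; ∈-map⁻; ∈-++⁺ˡ; ∈-++⁺ʳ; ∈-++⁻; ∈-filter⁺; ∈-filter⁻; ∈-cartesianProduct⁺; ∈-cartesianProduct⁻; ∈-upTo⁺)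
open import Data.List.Membership.Propositional.Properties.WithK using (unique∧set⇒bag)
open import Data.List.Properties
  using (length-++; length-map; filter-all; filter-none; filter-++; filter-accept; filter-reject;
         ++-identityʳ; map-injective; map-id-local; map-∘; partition-defn)
open import Data.List.Relation.Binary.BagAndSetEquality using (∼bag⇒↭)
open import Data.List.Relation.Binary.Equality.Propositional using (≋⇒≡)
open import Data.List.Relation.Binary.Permutation.Propositional
  using (_↭_; ↭-sym; ↭-trans; ↭-reflexive; ↭⇒↭ₛ; ↭ₛ⇒↭)
open import Data.List.Relation.Binary.Permutation.Propositional.Properties
  using (↭-length; All-resp-↭; filter-↭)
open import Relation.Binary.PropositionalEquality
open import Data.List.Relation.Binary.Permutation.Setoid (setoid ℕ) using () renaming (_↭_ to _↭ₛ_)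
open import Data.List.Relation.Binary.Permutation.Setoid.Properties (setoid ℕ) using (partition-↭)
open import Data.List.Relation.Unary.All using (All; []; _∷_; all?)
import Data.List.Relation.Unary.All as All
import Data.List.Relation.Unary.All.Properties as All
open import Data.List.Relation.Unary.AllPairs using ([]; _∷_)
open import Data.List.Relation.Unary.Any using (here; there)
open import Data.List.Relation.Unary.Linked using (Linked; []; [-]; _∷_)
import Data.List.Relation.Unary.Linked as Linked
import Data.List.Relation.Unary.Linked.Properties as Linked
open import Data.List.Relation.Unary.Sorted.TotalOrder.Properties using (↗↭↗⇒≋)
open import Data.List.Relation.Unary.Unique.Propositional using (Unique)
import Data.List.Relation.Unary.Unique.Propositional.Properties as Unique
open import Data.Nat.Divisibility using (_∣_; divides; m%n≡0⇒n∣m; n∣m⇒m%n≡0; m∣m*n; ∣-trans)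
open import Data.Nat.DivMod
  using (m%n<n; m%n%n≡m%n; m≡m%n+[m/n]*n; m∣n⇒o%n%m≡o%m; %-remove-+ʳ; %-distribˡ-+;
         m/n*n≤m; m*n/n≡m; m*[n/m]≡n; /-monoˡ-≤)
open import Data.Nat.Induction using (<-rec)
open import Data.Nat.ListAction using (sum)
open import Data.Nat.ListAction.Properties using (sum-++; sum-↭)
open import Data.Nat.Tactic.RingSolver using (solve-∀)
open import Data.Product using (_×_; _,_; proj₁; proj₂; ∃; ∃₂)
open import Data.Sum using (_⊎_; inj₁; inj₂; [_,_]′)
open import Data.Unit using (tt)
open import Function using (_∘_; id; _⇔_; mk⇔; Equivalence)
open import Level using (0ℓ)
open import Relation.Binary using (Rel)
import Relation.Binary as B
open import Relation.Binary.Properties.DecTotalOrder ≤-decTotalOrder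
  using (≥-decTotalOrder; ≥-totalOrder)
open import Data.List.Sort ≥-decTotalOrder using (sort; sort-↭; sort-↗)
open import Relation.Nullary using (¬_; Dec; yes; no; ¬?; _×-dec_; _⊎-dec_; _→-dec_; contradiction)
open import Relation.Nullary.Decidable using (toWitness)
open import Relation.Unary using (Pred; Decidable; ∁)

-- Convolution with the partition numbers

count : {K : Pred (List ℕ) 0ℓ} → Decidable K → ℕ → ℕ
count K? n = length (filter K? (partitions n))

-- Σ_{b < k} f (n − d b) p(b); the subtraction is exact as long as k ≤ 1 + n / d.
conv : ℕ → (ℕ → ℕ) → ℕ → ℕ → ℕ
conv d f n zero    = 0
conv d f n (suc k) = f (n ∸ d * k) * length (partitions k) + conv d f n k

conv-cong : ∀ d {f g} → (∀ n → f n ≡ g n) → ∀ n k → conv d f n k ≡ conv d g n k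
conv-cong d f≗g n zero    = refl
conv-cong d f≗g n (suc k) =
  cong₂ _+_ (cong (_* length (partitions k)) (f≗g (n ∸ d * k))) (conv-cong d f≗g n k)

-- The terms with `b > 0` agree and are cancelled from the top down; the remaining term carries the
-- weight p(0) = 1.
conv-cancel-tail : ∀ d {f g} n k →
  (∀ b → 0 < b → b ≤ k → f (n ∸ d * b) ≡ g (n ∸ d * b)) →
  conv d f n (suc k) ≡ conv d g n (suc k) → f n ≡ g n
conv-cancel-tail d {f} {g} n zero _ eq = begin
  f n                            ≡⟨ unfold f ⟩
  f (n ∸ d * 0) * 1 + 0          ≡⟨ eq ⟩
  g (n ∸ d * 0) * 1 + 0          ≡⟨ unfold g ⟨
  g n                            ∎
  where
  open ≡-Reasoning
  unfold : ∀ h → h n ≡ h (n ∸ d * 0) * 1 + 0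
  unfold h = sym (trans (+-identityʳ _)
    (trans (*-identityʳ _) (cong (λ x → h (n ∸ x)) (*-zeroʳ d))))
conv-cancel-tail d {f} {g} n (suc k) tail eq =
  conv-cancel-tail d n k (λ b 0<b b≤k → tail b 0<b (m≤n⇒m≤1+n b≤k))
    (+-cancelˡ-≡ (f (n ∸ d * suc k) * p) _ _
      (trans eq (cong (λ x → x * p + _) (sym (tail (suc k) z<s ≤-refl)))))
  where p = length (partitions (suc k))

module _ (d : ℕ) .{{_ : NonZero d}} where

  ≤/⇒*≤ : ∀ {b n} → b ≤ n / d → d * b ≤ n
  ≤/⇒*≤ {b} {n} b≤ = begin
    d * b       ≡⟨ *-comm d b ⟩
    b * d       ≤⟨ *-monoˡ-≤ d b≤ ⟩
    n / d * d   ≤⟨ m/n*n≤m n d ⟩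
    n           ∎
    where open ≤-Reasoning

  -- Strong induction on `n`: for `0 < b ≤ n / d` the argument `n ∸ d * b` is below `n`. In
  -- generating functions this divides by a series with constant term 1.
  conv-injective : ∀ {f g} →
    (∀ n → conv d f n (suc (n / d)) ≡ conv d g n (suc (n / d))) → ∀ n → f n ≡ g n
  conv-injective {f} {g} eq = <-rec _ λ n rec →
    conv-cancel-tail d n (n / d)
      (λ b 0<b b≤ → rec (∸-monoʳ-< (*-mono-< (>-nonZero⁻¹ d) 0<b) (≤/⇒*≤ b≤)))
      (eq n)

-- Counting through unique decompositions

length-cartesianProduct : ∀ {a b} {A : Set a} {B : Set b} (xs : List A) (ys : List B) →
  length (cartesianProduct xs ys) ≡ length xs * length ys
length-cartesianProduct []       ys = refl
length-cartesianProduct (x ∷ xs) ys = trans (length-++ (map (x ,_) ys))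
  (cong₂ _+_ (length-map (x ,_) ys) (length-cartesianProduct xs ys))

-- Injectivity is asked only on members, since a `combine` is injective only on admissible pairs of
-- partitions.
Unique-map : ∀ {a b} {A : Set a} {B : Set b} {f : A → B} {xs} →
  (∀ {x y} → x ∈ xs → y ∈ xs → f x ≡ f y → x ≡ y) → Unique xs → Unique (map f xs)
Unique-map inj []         = []
Unique-map inj (x∉ ∷ uxs) =
  All.map⁺ (All.tabulate λ y∈ fx≡fy → All.lookup x∉ y∈ (inj (here refl) (there y∈) fx≡fy))
  ∷ Unique-map (λ x∈ y∈ → inj (there x∈) (there y∈)) uxs

Partition : List ℕ → Set
Partition ps = IsPartition (sum ps) ps

∈-partitions⁻ : ∀ {n ps} → ps ∈ partitions n → Partition ps × sum ps ≡ n
∈-partitions⁻ {n} {ps} ps∈ with Equivalence.to (∈-partitions n ps) ps∈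
... | isPartition pos dec refl = isPartition pos dec refl , refl

∈-partitions⁺ : ∀ {ps n} → Partition ps → sum ps ≡ n → ps ∈ partitions n
∈-partitions⁺ p refl = Equivalence.from (∈-partitions _ _) p

-- A bijection from pairs of a partition in `K` and an arbitrary partition onto the partitions in
-- `Z`, the second component weighing `d` times its size: Z(q) = K(q) P(q^d).
record Splitting (d : ℕ) (Z K : Pred (List ℕ) 0ℓ) : Set where
  field
    combine    : List ℕ → List ℕ → List ℕ
    sum-combine : ∀ μ ν → sum (combine μ ν) ≡ sum μ + d * sum ν
    combine⁺   : ∀ {μ ν} → Partition μ → K μ → Partition ν →
                 Partition (combine μ ν) × Z (combine μ ν)
    injective  : ∀ {μ ν μ′ ν′} → Partition μ → K μ → Partition ν →
                 Partition μ′ → K μ′ → Partition ν′ →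
                 combine μ ν ≡ combine μ′ ν′ → (μ , ν) ≡ (μ′ , ν′)
    surjective : ∀ {ps} → Partition ps → Z ps → ∃₂ λ μ ν →
                 Partition μ × K μ × Partition ν × combine μ ν ≡ ps

module _ {d : ℕ} .{{_ : NonZero d}} {Z K : Pred (List ℕ) 0ℓ}
         (Z? : Decidable Z) (K? : Decidable K) (split : Splitting d Z K) (n : ℕ) where
  open Splitting split

  private
    block : ℕ → List (List ℕ × List ℕ)
    block b = cartesianProduct (filter K? (partitions (n ∸ d * b))) (partitions b)

    -- Follows the recursion of `conv`, so that lengths match block by block.
    pairs : ℕ → List (List ℕ × List ℕ)
    pairs zero    = []
    pairs (suc k) = block k ++ pairs k

    length-pairs : ∀ k → length (pairs k) ≡ conv d (count K?) n k
    length-pairs zero    = refl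
    length-pairs (suc k) = trans (length-++ (block k))
      (cong₂ _+_ (length-cartesianProduct (filter K? (partitions (n ∸ d * k))) (partitions k))
                 (length-pairs k))

    ∈-block⁻ : ∀ {b μ ν} → (μ , ν) ∈ block b →
      Partition μ × K μ × Partition ν × sum μ ≡ n ∸ d * b × sum ν ≡ b
    ∈-block⁻ {b} p∈ =
      let μ∈ , ν∈    = ∈-cartesianProduct⁻ (filter K? (partitions (n ∸ d * b))) (partitions b) p∈
          μ∈′ , Kμ   = ∈-filter⁻ K? μ∈
          pμ , sumμ  = ∈-partitions⁻ μ∈′
          pν , sumν  = ∈-partitions⁻ ν∈
      in pμ , Kμ , pν , sumμ , sumν

    ∈-pairs⁻ : ∀ k {μ ν} → (μ , ν) ∈ pairs k →
      Partition μ × K μ × Partition ν × sum μ ≡ n ∸ d * sum ν × sum ν < k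
    ∈-pairs⁻ (suc k) p∈ with ∈-++⁻ (block k) p∈
    ... | inj₁ p∈ˡ with ∈-block⁻ p∈ˡ
    ...   | pμ , Kμ , pν , sumμ , refl = pμ , Kμ , pν , sumμ , ≤-refl
    ∈-pairs⁻ (suc k) p∈ | inj₂ p∈ʳ with ∈-pairs⁻ k p∈ʳ
    ...   | pμ , Kμ , pν , sumμ , <k = pμ , Kμ , pν , sumμ , m<n⇒m<1+n <k

    ∈-pairs⁺ : ∀ k {μ ν} → Partition μ → K μ → Partition ν →
      sum μ ≡ n ∸ d * sum ν → sum ν < k → (μ , ν) ∈ pairs k
    ∈-pairs⁺ (suc k) {μ} {ν} pμ Kμ pν sumμ <k with sum ν ≟ k
    ... | yes refl = ∈-++⁺ˡ (∈-cartesianProduct⁺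
                       (∈-filter⁺ K? (∈-partitions⁺ pμ sumμ) Kμ) (∈-partitions⁺ pν refl))
    ... | no ≢k    = ∈-++⁺ʳ (block k)
                       (∈-pairs⁺ k pμ Kμ pν sumμ (≤∧≢⇒< (s≤s⁻¹ <k) ≢k))

    unique-pairs : ∀ k → Unique (pairs k)
    unique-pairs zero    = []
    unique-pairs (suc k) = Unique.++⁺
      (Unique.cartesianProduct⁺ (Unique.filter⁺ K? (partitions-unique (n ∸ d * k)))
                                (partitions-unique k))
      (unique-pairs k)
      -- The blocks are disjoint: `sum ν` is `k` in the new one and less than `k` in the others.
      (λ (p∈ˡ , p∈ʳ) →
        let _ , _ , _ , _ , ν≡k = ∈-block⁻ p∈ˡ
            _ , _ , _ , _ , ν<k = ∈-pairs⁻ k p∈ʳ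
        in <⇒≢ ν<k ν≡k)

    images : List (List ℕ)
    images = map (λ (μ , ν) → combine μ ν) (pairs (suc (n / d)))

    unique-images : Unique images
    unique-images = Unique-map
      (λ x∈ y∈ eq →
        let pμ , Kμ , pν , _ = ∈-pairs⁻ _ x∈
            pμ′ , Kμ′ , pν′ , _ = ∈-pairs⁻ _ y∈
        in injective pμ Kμ pν pμ′ Kμ′ pν′ eq)
      (unique-pairs (suc (n / d)))

    ∈-images⁻ : ∀ {ps} → ps ∈ images → ps ∈ filter Z? (partitions n)
    ∈-images⁻ ps∈ with ∈-map⁻ _ ps∈
    ... | (μ , ν) , p∈ , refl with ∈-pairs⁻ (suc (n / d)) p∈
    ...   | pμ , Kμ , pν , sumμ , s≤s ≤n/d =
      let pps , Zps = combine⁺ pμ Kμ pν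
      in ∈-filter⁺ Z? (∈-partitions⁺ pps
           (trans (sum-combine μ ν)
             -- Since `sum ν ≤ n / d`, the truncated subtraction in `sum μ ≡ n ∸ d * sum ν` is
             -- exact.
             (trans (cong (_+ d * sum ν) sumμ) (m∸n+n≡m (≤/⇒*≤ d ≤n/d))))) Zps

    ∈-images⁺ : ∀ {ps} → ps ∈ filter Z? (partitions n) → ps ∈ images
    ∈-images⁺ ps∈ with ∈-filter⁻ Z? ps∈
    ... | ps∈′ , Zps with ∈-partitions⁻ ps∈′
    ...   | pps , sum≡n with surjective pps Zps
    ...     | μ , ν , pμ , Kμ , pν , refl = ∈-map⁺ _ (∈-pairs⁺ (suc (n / d)) pμ Kμ pν
                (sym (trans (cong (_∸ d * sum ν) n≡) (m+n∸n≡m (sum μ) (d * sum ν))))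
                (s≤s (≤-trans (≤-reflexive (trans (sym (m*n/n≡m (sum ν) d)) (cong (_/ d) (*-comm (sum ν) d))))
                  (/-monoˡ-≤ d (≤-trans (m≤n+m _ (sum μ)) (≤-reflexive (sym n≡)))))))
        where
        n≡ : n ≡ sum μ + d * sum ν
        n≡ = trans (sym sum≡n) (sum-combine μ ν)

  -- Two duplicate-free lists with the same members are permutations of each other, so the images of
  -- the pairs are as numerous as the partitions in `Z`.
  count-splitting : count Z? n ≡ conv d (count K?) n (suc (n / d))
  count-splitting = begin
    count Z? n                              ≡⟨ ↭-length (∼bag⇒↭ (unique∧set⇒bag
                                                 (Unique.filter⁺ Z? (partitions-unique n)) unique-images
                                                 (mk⇔ ∈-images⁺ ∈-images⁻))) ⟩
    length images                           ≡⟨ length-map _ (pairs (suc (n / d))) ⟩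
    length (pairs (suc (n / d)))            ≡⟨ length-pairs (suc (n / d)) ⟩
    conv d (count K?) n (suc (n / d))       ∎
    where open ≡-Reasoning

-- Splitting off the multiples of d

sum-map-* : ∀ d ns → sum (map (d *_) ns) ≡ d * sum ns
sum-map-* d []       = sym (*-zeroʳ d)
sum-map-* d (n ∷ ns) =
  trans (cong (d * n +_) (sum-map-* d ns)) (sym (*-distribˡ-+ d n (sum ns)))

≥-sorted-unique : ∀ {xs ys} → Linked _≥_ xs → Linked _≥_ ys → xs ↭ ys → xs ≡ ys
≥-sorted-unique xs↗ ys↗ xs↭ys = ≋⇒≡ (↗↭↗⇒≋ ≥-totalOrder xs↗ ys↗ (↭⇒↭ₛ xs↭ys))

numParts-↭ : ∀ r d .{{_ : NonZero d}} {ps qs} → ps ↭ qs → numParts r d ps ≡ numParts r d qs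
numParts-↭ r d = ↭-length ∘ filter-↭ (λ p → p % d ≟ r)

numParts-++-none : ∀ r d .{{_ : NonZero d}} ps {qs} → All (λ q → q % d ≢ r) qs →
  numParts r d (ps ++ qs) ≡ numParts r d ps
numParts-++-none r d ps {qs} none = cong length (begin
  filter P? (ps ++ qs)            ≡⟨ filter-++ P? ps qs ⟩
  filter P? ps ++ filter P? qs    ≡⟨ cong (filter P? ps ++_) (filter-none P? none) ⟩
  filter P? ps ++ []              ≡⟨ ++-identityʳ _ ⟩
  filter P? ps                    ∎)
  where
  open ≡-Reasoning
  P? = λ p → p % d ≟ r

-- `Class₁` is by definition the instance `L = 0 ∷ 1 ∷ 3 ∷ 5 ∷ []`; the lists 1, 5 and 0, 1, 5 serve
-- the intermediate identities.
ResidueClass : List ℕ → ℕ → ℕ → List ℕ → Set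
ResidueClass L m₁ m₂ ps =
  All (λ p → p % 6 ∈ L) ps × numParts 1 6 ps ≡ m₁ × numParts 5 6 ps ≡ m₂

residueClass? : ∀ L m₁ m₂ → Decidable (ResidueClass L m₁ m₂)
residueClass? L m₁ m₂ ps =
  all? (λ p → (p % 6) ∈? L) ps ×-dec (numParts 1 6 ps ≟ m₁) ×-dec (numParts 5 6 ps ≟ m₂)

Unit : ℕ → Set
Unit p = p % 6 ∈ 1 ∷ 5 ∷ []

unit? : Decidable Unit
unit? p = (p % 6) ∈? (1 ∷ 5 ∷ [])

module _ (d : ℕ) .{{_ : NonZero d}} (3∣d : 3 ∣ d) (L : List ℕ)
         (∈L⇔ : ∀ p → p % 6 ∈ L ⇔ (Unit p ⊎ d ∣ p)) (m₁ m₂ : ℕ) where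

  private
    -- Residues 1 and 5 mod 6 are nonzero mod 3, whereas `3 ∣ d`. Hence scaled parts never mix with
    -- units.
    multiple⇒¬unit : ∀ {p} → d ∣ p → ¬ Unit p
    multiple⇒¬unit {p} d∣p u =
      table u (trans (m∣n⇒o%n%m≡o%m 3 6 p (divides 2 refl)) (n∣m⇒m%n≡0 p 3 (∣-trans 3∣d d∣p)))
      where
      table : ∀ {r} → r ∈ 1 ∷ 5 ∷ [] → r % 3 ≢ 0
      table (here refl)         ()
      table (there (here refl)) ()

    scale : List ℕ → List ℕ
    scale = map (d *_)

    scale-¬unit : ∀ ν → All (∁ Unit) (scale ν)
    scale-¬unit ν = All.map⁺ (All.universal (λ b → multiple⇒¬unit (m∣m*n b)) ν)

    combine : List ℕ → List ℕ → List ℕ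
    combine σ ν = sort (σ ++ scale ν)

    combine-↭ : ∀ σ ν → combine σ ν ↭ σ ++ scale ν
    combine-↭ σ ν = sort-↭ (σ ++ scale ν)

    sum-combine : ∀ σ ν → sum (combine σ ν) ≡ sum σ + d * sum ν
    sum-combine σ ν = begin
      sum (combine σ ν)           ≡⟨ sum-↭ (combine-↭ σ ν) ⟩
      sum (σ ++ scale ν)          ≡⟨ sum-++ σ (scale ν) ⟩
      sum σ + sum (scale ν)       ≡⟨ cong (sum σ +_) (sum-map-* d ν) ⟩
      sum σ + d * sum ν           ∎
      where open ≡-Reasoning

    numParts-combine : ∀ r → r ∈ 1 ∷ 5 ∷ [] → ∀ σ ν →
      numParts r 6 (combine σ ν) ≡ numParts r 6 σ
    numParts-combine r r∈ σ ν = trans (numParts-↭ r 6 (combine-↭ σ ν))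
      (numParts-++-none r 6 σ (All.map (λ { ¬u refl → ¬u r∈ }) (scale-¬unit ν)))

    units-++ : ∀ {σ} → All Unit σ → ∀ ν → filter unit? (σ ++ scale ν) ≡ σ
    units-++ {σ} u ν = trans (filter-++ unit? σ (scale ν))
      (trans (cong₂ _++_ (filter-all unit? u) (filter-none unit? (scale-¬unit ν))) (++-identityʳ σ))

    multiples-++ : ∀ {σ} → All Unit σ → ∀ ν → filter (¬? ∘ unit?) (σ ++ scale ν) ≡ scale ν
    multiples-++ {σ} u ν = trans (filter-++ (¬? ∘ unit?) σ (scale ν))
      (cong₂ _++_ (filter-none (¬? ∘ unit?) (All.map (λ u ¬u → ¬u u) u))
                  (filter-all (¬? ∘ unit?) (scale-¬unit ν)))

    scale-sorted : ∀ {ν} → Linked _≥_ ν → Linked _≥_ (scale ν)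
    scale-sorted = Linked.map⁺ ∘ Linked.map (*-monoʳ-≤ d)

    combine⁺ : ∀ {σ ν} → Partition σ → ResidueClass (1 ∷ 5 ∷ []) m₁ m₂ σ → Partition ν →
      Partition (combine σ ν) × ResidueClass L m₁ m₂ (combine σ ν)
    combine⁺ {σ} {ν} (isPartition σ>0 _ _) (u , eq₁ , eq₂) (isPartition ν>0 _ _) =
      isPartition
        (All-resp-↭ (↭-sym (combine-↭ σ ν))
          (All.++⁺ σ>0 (All.map⁺ (All.map (λ 0<b → *-mono-< (>-nonZero⁻¹ d) 0<b) ν>0))))
        (sort-↗ (σ ++ scale ν))
        refl ,
      All-resp-↭ (↭-sym (combine-↭ σ ν))
        (All.++⁺ (All.map (λ {p} → Equivalence.from (∈L⇔ p) ∘ inj₁) u)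
                 (All.map⁺ (All.universal (λ b → Equivalence.from (∈L⇔ (d * b)) (inj₂ (m∣m*n b))) ν))) ,
      trans (numParts-combine 1 (here refl) σ ν) eq₁ ,
      trans (numParts-combine 5 (there (here refl)) σ ν) eq₂

    -- Filtering by `unit?` and by its complement separates the two ingredients up to permutation;
    -- sortedness turns the permutations into equalities, and the factor `d` cancels.
    combine-injective : ∀ {σ ν σ′ ν′} →
      Partition σ → ResidueClass (1 ∷ 5 ∷ []) m₁ m₂ σ → Partition ν →
      Partition σ′ → ResidueClass (1 ∷ 5 ∷ []) m₁ m₂ σ′ → Partition ν′ →
      combine σ ν ≡ combine σ′ ν′ → (σ , ν) ≡ (σ′ , ν′)
    combine-injective {σ} {ν} {σ′} {ν′}
      (isPartition _ σ↘ _) (u , _) (isPartition _ ν↘ _) (isPartition _ σ′↘ _) (u′ , _) (isPartition _ ν′↘ _) eq =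
      cong₂ _,_
        (≥-sorted-unique σ↘ σ′↘
          (subst₂ _↭_ (units-++ u ν) (units-++ u′ ν′) (filter-↭ unit? σ++ν↭)))
        (map-injective (*-cancelˡ-≡ _ _ d)
          (≥-sorted-unique (scale-sorted ν↘) (scale-sorted ν′↘)
            (subst₂ _↭_ (multiples-++ u ν) (multiples-++ u′ ν′) (filter-↭ (¬? ∘ unit?) σ++ν↭))))
      where
      σ++ν↭ : σ ++ scale ν ↭ σ′ ++ scale ν′
      σ++ν↭ = ↭-trans (↭-sym (combine-↭ σ ν)) (↭-trans (↭-reflexive eq) (combine-↭ σ′ ν′))

    combine-surjective : ∀ {ps} → Partition ps → ResidueClass L m₁ m₂ ps → ∃₂ λ σ ν →
      Partition σ × ResidueClass (1 ∷ 5 ∷ []) m₁ m₂ σ × Partition ν × combine σ ν ≡ ps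
    combine-surjective {ps} (isPartition ps>0 ps↘ _) (∈L , eq₁ , eq₂) =
      σ , ν ,
      isPartition (All.filter⁺ unit? ps>0) (Linked.filter⁺ unit? (λ p q → ≤-trans q p) ps↘) refl ,
      (All.all-filter unit? ps ,
       trans (sym (numParts-combine 1 (here refl) σ ν)) (trans (cong (numParts 1 6) combine≡) eq₁) ,
       trans (sym (numParts-combine 5 (there (here refl)) σ ν)) (trans (cong (numParts 5 6) combine≡) eq₂)) ,
      isPartition ν>0
        (Linked.map⁺ (Linked.map (/-monoˡ-≤ d)
          (Linked.filter⁺ (¬? ∘ unit?) (λ p q → ≤-trans q p) ps↘))) refl ,
      combine≡
      where
      σ = filter unit? ps
      τ = filter (¬? ∘ unit?) ps
      ν = map (_/ d) τ

      -- By `∈L⇔` an allowed part that is no unit is a multiple of `d`, so the division defining `ν`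
      -- is exact.
      d∣τ : All (d ∣_) τ
      d∣τ = All.zipWith
        (λ {p} (∈L , ¬u) → [ (λ u → contradiction u ¬u) , id ]′ (Equivalence.to (∈L⇔ p) ∈L))
        (All.filter⁺ (¬? ∘ unit?) ∈L , All.all-filter (¬? ∘ unit?) ps)

      scale-ν : scale ν ≡ τ
      scale-ν = trans (sym (map-∘ τ)) (map-id-local (All.map m*[n/m]≡n d∣τ))

      ν>0 : All (0 <_) ν
      ν>0 = All.map (λ {b} 0<db → n≢0⇒n>0 λ { refl → <⇒≢ 0<db (sym (*-zeroʳ d)) })
        (All.map⁻ (subst (All (0 <_)) (sym scale-ν) (All.filter⁺ (¬? ∘ unit?) ps>0)))

      ps↭ : ps ↭ σ ++ τ
      ps↭ = ↭ₛ⇒↭ (subst (λ (ys , zs) → ps ↭ₛ ys ++ zs) (partition-defn unit? ps)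
                    (partition-↭ unit? ps))

      combine≡ : combine σ ν ≡ ps
      combine≡ = ≥-sorted-unique (sort-↗ _) ps↘
        (↭-trans (combine-↭ σ ν) (↭-trans (↭-reflexive (cong (σ ++_) scale-ν)) (↭-sym ps↭)))

  residueSplitting : Splitting d (ResidueClass L m₁ m₂) (ResidueClass (1 ∷ 5 ∷ []) m₁ m₂)
  residueSplitting = record
    { combine     = combine
    ; sum-combine = sum-combine
    ; combine⁺    = combine⁺
    ; injective   = combine-injective
    ; surjective  = combine-surjective
    }

∈0135⇔ : ∀ p → p % 6 ∈ 0 ∷ 1 ∷ 3 ∷ 5 ∷ [] ⇔ (Unit p ⊎ 3 ∣ p)
∈0135⇔ p = mk⇔ to from
  where
  %6%3 : p % 6 % 3 ≡ p % 3
  %6%3 = m∣n⇒o%n%m≡o%m 3 6 p (divides 2 refl)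
  to : p % 6 ∈ 0 ∷ 1 ∷ 3 ∷ 5 ∷ [] → Unit p ⊎ 3 ∣ p
  to (here eq)                         = inj₂ (m%n≡0⇒n∣m p 3 (trans (sym %6%3) (cong (_% 3) eq)))
  to (there (here eq))                 = inj₁ (here eq)
  to (there (there (here eq)))         = inj₂ (m%n≡0⇒n∣m p 3 (trans (sym %6%3) (cong (_% 3) eq)))
  to (there (there (there (here eq)))) = inj₁ (there (here eq))
  from : Unit p ⊎ 3 ∣ p → p % 6 ∈ 0 ∷ 1 ∷ 3 ∷ 5 ∷ []
  from (inj₁ (here eq))         = there (here eq)
  from (inj₁ (there (here eq))) = there (there (there (here eq)))
  from (inj₂ 3∣p) = table (m%n<n p 6) (trans %6%3 (n∣m⇒m%n≡0 p 3 3∣p))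
    where
    table : ∀ {r} → r < 6 → r % 3 ≡ 0 → r ∈ 0 ∷ 1 ∷ 3 ∷ 5 ∷ []
    table {0} _ _ = here refl
    table {3} _ _ = there (there (here refl))
    table {suc (suc (suc (suc (suc (suc _)))))} (s≤s (s≤s (s≤s (s≤s (s≤s (s≤s ()))))))

∈015⇔ : ∀ p → p % 6 ∈ 0 ∷ 1 ∷ 5 ∷ [] ⇔ (Unit p ⊎ 6 ∣ p)
∈015⇔ p = mk⇔
  (λ { (here eq) → inj₂ (m%n≡0⇒n∣m p 6 eq) ; (there u) → inj₁ u })
  (λ { (inj₁ u) → there u ; (inj₂ 6∣p) → here (n∣m⇒m%n≡0 p 6 6∣p) })

-- Splitting off a minimal chain

-- The default 0 treats a list of parts as a sequence continued by zeros.
head₀ : List ℕ → ℕ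
head₀ []      = 0
head₀ (x ∷ _) = x

-- Unlike `Linked`, this also relates the last entry to 0, which lets the ban on the part 2 become a
-- gap condition.
data Chain (R : Rel ℕ 0ℓ) : List ℕ → Set where
  []  : Chain R []
  _∷_ : ∀ {x xs} → R x (head₀ xs) → Chain R xs → Chain R (x ∷ xs)

module _ {R : Rel ℕ 0ℓ} where

  chain? : B.Decidable R → Decidable (Chain R)
  chain? R? []       = yes []
  chain? R? (x ∷ xs) with R? x (head₀ xs) | chain? R? xs
  ... | yes r | yes c = yes (r ∷ c)
  ... | no ¬r | _     = no λ { (r ∷ _) → ¬r r }
  ... | yes _ | no ¬c = no λ { (_ ∷ c) → ¬c c }

  chain-drop : ∀ {xs} → Chain R xs → Chain R (drop 1 xs)
  chain-drop []      = []
  chain-drop (_ ∷ c) = c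

  chain-head : R 0 0 → ∀ {xs} → Chain R xs → R (head₀ xs) (head₀ (drop 1 xs))
  chain-head r₀ []      = r₀
  chain-head r₀ (r ∷ _) = r

  chain⇒linked : ∀ {xs} → Chain R xs → Linked R xs
  chain⇒linked []            = []
  chain⇒linked (_ ∷ [])      = [-]
  chain⇒linked (r ∷ r′ ∷ c) = r ∷ chain⇒linked (r′ ∷ c)

chain-map : ∀ {R S : Rel ℕ 0ℓ} → (∀ {a b} → R a b → S a b) → ∀ {xs} → Chain R xs → Chain S xs
chain-map f []      = []
chain-map f (r ∷ c) = f r ∷ chain-map f c

≥-linked⇒chain : ∀ {xs} → Linked _≥_ xs → Chain _≥_ xs
≥-linked⇒chain []      = []
≥-linked⇒chain [-]     = z≤n ∷ []
≥-linked⇒chain (r ∷ l) = r ∷ ≥-linked⇒chain l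

Positive : List ℕ → Set
Positive = All (0 <_)

-- With positive entries, `head₀` is 0 only for the empty list, so zero-padded comparison loses
-- nothing.
positive-ext : ∀ {xs ys} → Positive xs → Positive ys →
  head₀ xs ≡ head₀ ys → drop 1 xs ≡ drop 1 ys → xs ≡ ys
positive-ext []         []         _    _    = refl
positive-ext []         (() ∷ _)   refl _
positive-ext (() ∷ _)   []         refl _
positive-ext (_ ∷ _)    (_ ∷ _)    refl refl = refl

cons₀ : ℕ → List ℕ → List ℕ
cons₀ zero    xs = xs
cons₀ (suc x) xs = suc x ∷ xs

cons₀-positive : ∀ x {xs} → Positive xs → Positive (cons₀ x xs)
cons₀-positive zero    p = p
cons₀-positive (suc x) p = z<s ∷ p

cons₀-chain : ∀ {R : Rel ℕ 0ℓ} x {xs} → R x (head₀ xs) → Chain R xs → Chain R (cons₀ x xs)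
cons₀-chain zero    r c = c
cons₀-chain (suc x) r c = r ∷ c

head₀-cons₀ : ∀ x {xs} → head₀ xs ≤ x → head₀ (cons₀ x xs) ≡ x
head₀-cons₀ zero    ≤x = n≤0⇒n≡0 ≤x
head₀-cons₀ (suc x) _  = refl

-- A zero is suppressed by `cons₀`; this is harmless because a positive list with head at most 0 is
-- empty.
drop-cons₀ : ∀ x {xs} → Positive xs → head₀ xs ≤ x → drop 1 (cons₀ x xs) ≡ xs
drop-cons₀ zero    []      _   = refl
drop-cons₀ zero    (p ∷ _) ≤0  = contradiction (≤-trans p ≤0) λ ()
drop-cons₀ (suc x) _       _   = refl

-- The least admissible difference of adjacent parts, the smaller being ≡ r and
-- the larger ≡ s (mod 3), under the gap rules of C₂.  It is also the difference mod 6 of the residues that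
-- r and s stand for under 0 ↦ 0, 1 ↦ 1, 2 ↦ 5.
δ : ℕ → ℕ → ℕ
δ 0 1 = 1
δ 0 2 = 5
δ 1 0 = 5
δ 1 2 = 4
δ 2 0 = 1
δ 2 1 = 2
δ _ _ = 0

-- On the right, `a` enters only through its residue mod 3; for given `b` each residue class
-- contains exactly one such `a`.
Minimal : Rel ℕ 0ℓ
Minimal a b = a ≡ b + δ (b % 3) (a % 3)

Step : ℕ → Rel ℕ 0ℓ
Step d a b = ∃ λ j → a ≡ b + δ (b % 3) (a % 3) + d * j

minimal⇒≥ : ∀ {a b} → Minimal a b → a ≥ b
minimal⇒≥ {a} {b} min = ≤-trans (m≤m+n b _) (≤-reflexive (sym min))

step⇒≥ : ∀ d {a b} → Step d a b → a ≥ b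
step⇒≥ d {a} {b} (j , eq) =
  ≤-trans (≤-trans (m≤m+n b _) (m≤m+n _ (d * j))) (≤-reflexive (sym eq))

ChainClass : Rel ℕ 0ℓ → ℕ → ℕ → List ℕ → Set
ChainClass R m₁ m₂ ps = Chain R ps × numParts 1 3 ps ≡ m₁ × numParts 2 3 ps ≡ m₂

minimalClass? : ∀ m₁ m₂ → Decidable (ChainClass Minimal m₁ m₂)
minimalClass? m₁ m₂ ps =
  chain? (λ a b → a ≟ b + δ (b % 3) (a % 3)) ps
  ×-dec (numParts 1 3 ps ≟ m₁) ×-dec (numParts 2 3 ps ≟ m₂)

module _ (r d : ℕ) .{{_ : NonZero d}} where

  numParts-∷ : ∀ x y {xs ys} → x % d ≡ y % d → numParts r d xs ≡ numParts r d ys →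
    numParts r d (x ∷ xs) ≡ numParts r d (y ∷ ys)
  numParts-∷ x y x≡y eq with x % d ≟ r
  ... | yes x≡r = trans (cong length (filter-accept P? x≡r))
      (trans (cong suc eq) (sym (cong length (filter-accept P? (trans (sym x≡y) x≡r)))))
    where P? = λ p → p % d ≟ r
  ... | no  x≢r = trans (cong length (filter-reject P? x≢r))
      (trans eq (sym (cong length (filter-reject P? (x≢r ∘ trans x≡y)))))
    where P? = λ p → p % d ≟ r

  numParts-∷-≢ : ∀ x {xs} → x % d ≢ r → numParts r d (x ∷ xs) ≡ numParts r d xs
  numParts-∷-≢ x x≢r = cong length (filter-reject (λ p → p % d ≟ r) x≢r)

module _ (d : ℕ) .{{_ : NonZero d}} (3∣d : 3 ∣ d) where

  infixl 6 _⊞_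
  -- Entrywise μ + d ν, the shorter list padded with zeros. Leaving `a + d * 0` unsimplified gives
  -- the heads of all nonempty cases one shape.
  _⊞_ : List ℕ → List ℕ → List ℕ
  []      ⊞ []      = []
  []      ⊞ (b ∷ ν) = 0 + d * b ∷ [] ⊞ ν
  (a ∷ μ) ⊞ []      = a + d * 0 ∷ μ ⊞ []
  (a ∷ μ) ⊞ (b ∷ ν) = a + d * b ∷ μ ⊞ ν

  head-⊞ : ∀ μ ν → head₀ (μ ⊞ ν) ≡ head₀ μ + d * head₀ ν
  head-⊞ []      []      = sym (*-zeroʳ d)
  head-⊞ []      (_ ∷ _) = refl
  head-⊞ (_ ∷ _) []      = refl
  head-⊞ (_ ∷ _) (_ ∷ _) = refl

  drop-⊞ : ∀ μ ν → drop 1 (μ ⊞ ν) ≡ drop 1 μ ⊞ drop 1 ν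
  drop-⊞ []      []      = refl
  drop-⊞ []      (_ ∷ _) = refl
  drop-⊞ (_ ∷ _) []      = refl
  drop-⊞ (_ ∷ _) (_ ∷ _) = refl

  ⊞-empty : ∀ μ ν → μ ⊞ ν ≡ [] → μ ≡ [] × ν ≡ []
  ⊞-empty []      []      _  = refl , refl
  ⊞-empty []      (_ ∷ _) ()
  ⊞-empty (_ ∷ _) []      ()
  ⊞-empty (_ ∷ _) (_ ∷ _) ()

  sum-⊞ : ∀ μ ν → sum (μ ⊞ ν) ≡ sum μ + d * sum ν
  sum-⊞ []      []      = sym (*-zeroʳ d)
  sum-⊞ []      (b ∷ ν) = trans (cong (d * b +_) (sum-⊞ [] ν)) (sym (*-distribˡ-+ d b (sum ν)))
  sum-⊞ (a ∷ μ) []      = trans (cong (a + d * 0 +_) (sum-⊞ μ [])) (rearrange a d (sum μ))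
    where
    rearrange : ∀ a d s → a + d * 0 + (s + d * 0) ≡ a + s + d * 0
    rearrange = solve-∀
  sum-⊞ (a ∷ μ) (b ∷ ν) = trans (cong (a + d * b +_) (sum-⊞ μ ν)) (rearrange a b d (sum μ) (sum ν))
    where
    rearrange : ∀ a b d s t → a + d * b + (s + d * t) ≡ a + s + d * (b + t)
    rearrange = solve-∀

  +d*-%3 : ∀ a b → (a + d * b) % 3 ≡ a % 3
  +d*-%3 a b = %-remove-+ʳ a (∣-trans 3∣d (m∣m*n b))

  -- Multiples of `d` do not change residues mod 3. Beyond the end of `μ` the entries are themselves
  -- multiples of 3, hence not counted for `r ≢ 0`.
  numParts-⊞ : ∀ r → r ≢ 0 → ∀ μ ν → numParts r 3 (μ ⊞ ν) ≡ numParts r 3 μ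
  numParts-⊞ r r≢0 []      []      = refl
  numParts-⊞ r r≢0 []      (b ∷ ν) =
    trans (numParts-∷-≢ r 3 (0 + d * b) (λ ≡r → r≢0 (trans (sym ≡r) (+d*-%3 0 b)))) (numParts-⊞ r r≢0 [] ν)
  numParts-⊞ r r≢0 (a ∷ μ) []      = numParts-∷ r 3 (a + d * 0) a (+d*-%3 a 0) (numParts-⊞ r r≢0 μ [])
  numParts-⊞ r r≢0 (a ∷ μ) (b ∷ ν) = numParts-∷ r 3 (a + d * b) a (+d*-%3 a b) (numParts-⊞ r r≢0 μ ν)

  positive-⊞ : ∀ {μ ν} → Positive μ → Positive ν → Positive (μ ⊞ ν)
  positive-⊞ []       []       = []
  positive-⊞ []       (q ∷ qs) = *-mono-< (>-nonZero⁻¹ d) q ∷ positive-⊞ [] qs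
  positive-⊞ (p ∷ ps) []       = m≤n⇒m≤n+o _ p ∷ positive-⊞ ps []
  positive-⊞ (p ∷ ps) (q ∷ qs) = m≤n⇒m≤n+o _ p ∷ positive-⊞ ps qs

  step⁺ : ∀ {a b a′ b′} → Minimal a b → b′ ≤ a′ → Step d (a + d * a′) (b + d * b′)
  step⁺ {a} {b} {a′} {b′} min b′≤a′ = a′ ∸ b′ , (begin
    a + d * a′                                      ≡⟨ cong₂ (λ x y → x + d * y) min (sym (m+[n∸m]≡n b′≤a′)) ⟩
    b + δ (b % 3) (a % 3) + d * (b′ + (a′ ∸ b′))   ≡⟨ rearrange b (δ (b % 3) (a % 3)) d b′ (a′ ∸ b′) ⟩
    b + d * b′ + δ (b % 3) (a % 3) + d * (a′ ∸ b′) ≡⟨ cong₂ (λ x y → b + d * b′ + δ x y + d * (a′ ∸ b′))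
                                                         (+d*-%3 b b′) (+d*-%3 a a′) ⟨
    b + d * b′ + δ ((b + d * b′) % 3) ((a + d * a′) % 3) + d * (a′ ∸ b′) ∎)
    where
    open ≡-Reasoning
    rearrange : ∀ b x d b′ j → b + x + d * (b′ + j) ≡ b + d * b′ + x + d * j
    rearrange = solve-∀

  -- The residue of `x` mod 3 selects the minimal `a` over `b`, and the multiple `j` in the step is
  -- the excess of `a′` over `b′`.
  step⁻ : ∀ {x b b′} → Step d x (b + d * b′) → ∃₂ λ a a′ →
    Minimal a b × b′ ≤ a′ × x ≡ a + d * a′
  step⁻ {x} {b} {b′} (j , eq) = a , b′ + j , minimal , m≤m+n b′ j , x≡
    where
    a = b + δ (b % 3) (x % 3)
    rearrange : ∀ b x d b′ j → b + d * b′ + x + d * j ≡ b + x + d * (b′ + j)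
    rearrange = solve-∀
    x≡ : x ≡ a + d * (b′ + j)
    x≡ = trans eq (trans (cong (λ r → b + d * b′ + δ r (x % 3) + d * j) (+d*-%3 b b′))
                         (rearrange b (δ (b % 3) (x % 3)) d b′ j))
    minimal : Minimal a b
    minimal = cong (λ s → b + δ (b % 3) s) (trans (cong (_% 3) x≡) (+d*-%3 a (b′ + j)))

  step-∷ : ∀ {a b} μ ν → Minimal a (head₀ μ) → b ≥ head₀ ν → Step d (a + d * b) (head₀ (μ ⊞ ν))
  step-∷ {a} {b} μ ν min ≥b = subst (Step d (a + d * b)) (sym (head-⊞ μ ν)) (step⁺ {b = head₀ μ} min ≥b)

  chain-⊞ : ∀ {μ ν} → Chain Minimal μ → Chain _≥_ ν → Chain (Step d) (μ ⊞ ν)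
  chain-⊞ []                   []                   = []
  -- Beyond the end of `μ` the padding is the minimal step from 0 to 0, hence `refl`.
  chain-⊞ []                   (_∷_ {xs = ν} q qs)  = step-∷ [] ν refl q ∷ chain-⊞ [] qs
  chain-⊞ (_∷_ {xs = μ} p ps)  []                   = step-∷ μ [] p z≤n ∷ chain-⊞ ps []
  chain-⊞ (_∷_ {xs = μ} p ps)  (_∷_ {xs = ν} q qs)  = step-∷ μ ν p q ∷ chain-⊞ ps qs

  -- The decomposition is forced from the last part upwards: once the tails agree, the residue of
  -- `x` mod 3 fixes the head of the minimal chain, and subtracting it fixes the head of `ν`. The
  -- common value `ps` is explicit to recurse on.
  ⊞-injective : ∀ ps {μ ν μ′ ν′} →
    Positive μ → Chain Minimal μ → Positive ν → Positive μ′ → Chain Minimal μ′ → Positive ν′ →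
    μ ⊞ ν ≡ ps → μ′ ⊞ ν′ ≡ ps → μ ≡ μ′ × ν ≡ ν′
  ⊞-injective [] {μ} {ν} {μ′} {ν′} _ _ _ _ _ _ eq eq′
    with refl , refl ← ⊞-empty μ ν eq | refl , refl ← ⊞-empty μ′ ν′ eq′ = refl , refl
  ⊞-injective (x ∷ xs) {μ} {ν} {μ′} {ν′} μ>0 cμ ν>0 μ′>0 cμ′ ν′>0 eq eq′ =
    positive-ext μ>0 μ′>0 heads (proj₁ tails) ,
    positive-ext ν>0 ν′>0
      (*-cancelˡ-≡ _ _ d (+-cancelˡ-≡ (head₀ μ) _ _ (begin
        head₀ μ + d * head₀ ν     ≡⟨ head-eq eq ⟨
        x                         ≡⟨ head-eq eq′ ⟩
        head₀ μ′ + d * head₀ ν′   ≡⟨ cong (_+ d * head₀ ν′) heads ⟨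
        head₀ μ + d * head₀ ν′    ∎)))
      (proj₂ tails)
    where
    open ≡-Reasoning
    head-eq : ∀ {μ ν} → μ ⊞ ν ≡ x ∷ xs → x ≡ head₀ μ + d * head₀ ν
    head-eq {μ} {ν} eq = trans (sym (cong head₀ eq)) (head-⊞ μ ν)
    tails = ⊞-injective xs (All.drop⁺ 1 μ>0) (chain-drop cμ) (All.drop⁺ 1 ν>0)
      (All.drop⁺ 1 μ′>0) (chain-drop cμ′) (All.drop⁺ 1 ν′>0)
      (trans (sym (drop-⊞ μ ν)) (cong (drop 1) eq)) (trans (sym (drop-⊞ μ′ ν′)) (cong (drop 1) eq′))
    head-μ : ∀ {μ ν} → Chain Minimal μ → μ ⊞ ν ≡ x ∷ xs →
      head₀ μ ≡ head₀ (drop 1 μ) + δ (head₀ (drop 1 μ) % 3) (x % 3)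
    head-μ {μ} {ν} cμ eq = trans (chain-head refl cμ)
      (cong (λ s → head₀ (drop 1 μ) + δ (head₀ (drop 1 μ) % 3) s)
        (sym (trans (cong (_% 3) (head-eq {μ} {ν} eq)) (+d*-%3 (head₀ μ) (head₀ ν)))))
    heads : head₀ μ ≡ head₀ μ′
    heads = trans (head-μ {μ} {ν} cμ eq)
      (trans (cong (λ t → head₀ t + δ (head₀ t % 3) (x % 3)) (proj₁ tails))
             (sym (head-μ {μ′} {ν′} cμ′ eq′)))

  -- Built from the last part upwards: `step⁻` splits `x` over the heads already found, and `cons₀`
  -- omits zero components.
  ⊞-surjective : ∀ {ps} → Positive ps → Chain (Step d) ps → ∃₂ λ μ ν →
    Positive μ × Chain Minimal μ × Positive ν × Chain _≥_ ν × μ ⊞ ν ≡ ps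
  ⊞-surjective []                        []      = [] , [] , [] , [] , [] , [] , refl
  ⊞-surjective {x ∷ xs} (0<x ∷ xs>0) (s ∷ c)
    with μ , ν , μ>0 , cμ , ν>0 , cν , refl ← ⊞-surjective xs>0 c
    with a , b , min , ≥ν , refl ← step⁻ {x} {head₀ μ} {head₀ ν} (subst (Step d x) (head-⊞ μ ν) s) =
    cons₀ a μ , cons₀ b ν ,
    cons₀-positive a μ>0 , cons₀-chain a min cμ ,
    cons₀-positive b ν>0 , cons₀-chain b ≥ν cν ,
    positive-ext (positive-⊞ (cons₀-positive a μ>0) (cons₀-positive b ν>0)) (0<x ∷ xs>0)
      (trans (head-⊞ (cons₀ a μ) (cons₀ b ν))
        (cong₂ (λ u v → u + d * v) (head₀-cons₀ a (minimal⇒≥ {a} min)) (head₀-cons₀ b ≥ν)))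
      (trans (drop-⊞ (cons₀ a μ) (cons₀ b ν))
        (cong₂ _⊞_ (drop-cons₀ a μ>0 (minimal⇒≥ {a} min)) (drop-cons₀ b ν>0 ≥ν)))

  -- The factor `ChainClass Minimal` does not depend on `d`; this is what carries information from
  -- `d = 6` to `d = 3`.
  chainSplitting : ∀ {Z : Pred (List ℕ) 0ℓ} m₁ m₂ →
    (∀ {ps} → Partition ps → Z ps ⇔ ChainClass (Step d) m₁ m₂ ps) →
    Splitting d Z (ChainClass Minimal m₁ m₂)
  chainSplitting m₁ m₂ Z⇔ = record
    { combine     = _⊞_
    ; sum-combine = sum-⊞
    ; combine⁺    = λ { {μ} {ν} (isPartition μ>0 _ _) (cμ , eq₁ , eq₂) (isPartition ν>0 ν↘ _) →
        let c = chain-⊞ cμ (≥-linked⇒chain ν↘)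
            p = isPartition (positive-⊞ μ>0 ν>0) (chain⇒linked (chain-map (step⇒≥ d) c)) refl
        in p , Equivalence.from (Z⇔ p)
             (c , trans (numParts-⊞ 1 (λ ()) μ ν) eq₁ , trans (numParts-⊞ 2 (λ ()) μ ν) eq₂) }
    ; injective   = λ { (isPartition μ>0 _ _) (cμ , _) (isPartition ν>0 _ _)
                        (isPartition μ′>0 _ _) (cμ′ , _) (isPartition ν′>0 _ _) eq →
        let μ≡ , ν≡ = ⊞-injective _ μ>0 cμ ν>0 μ′>0 cμ′ ν′>0 eq refl in cong₂ _,_ μ≡ ν≡ }
    ; surjective  = λ { p Zps →
        let c , eq₁ , eq₂ = Equivalence.to (Z⇔ p) Zps
            μ , ν , μ>0 , cμ , ν>0 , cν , eq = ⊞-surjective (IsPartition.positive p) c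
        in μ , ν ,
           isPartition μ>0 (chain⇒linked (chain-map (λ {a} → minimal⇒≥ {a}) cμ)) refl ,
           (cμ , trans (sym (numParts-⊞ 1 (λ ()) μ ν)) (trans (cong (numParts 1 3) eq) eq₁)
               , trans (sym (numParts-⊞ 2 (λ ()) μ ν)) (trans (cong (numParts 2 3) eq) eq₂)) ,
           isPartition ν>0 (chain⇒linked cν) refl ,
           eq }
    }

-- Identifying the chains for d = 3 and d = 6

-- `Gap a b` in terms of the difference and the residue of the smaller part, so that it can be
-- checked on finitely many cases.
GapRule : ℕ → ℕ → Set
GapRule g r = (g ≡ 1 → r ≢ 1) × (g ≡ 2 → r ≡ 2)

gapRule? : ∀ g r → Dec (GapRule g r)
gapRule? g r = ((g ≟ 1) →-dec ¬? (r ≟ 1)) ×-dec ((g ≟ 2) →-dec (r ≟ 2))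

GapRule-≥3 : ∀ {g} r → 3 ≤ g → GapRule g r
GapRule-≥3 r (s≤s (s≤s (s≤s _))) = (λ ()) , λ ()

-- For a difference with residue `s`, the least admissible value is `s` itself if the rule permits
-- it, and `s + 3` otherwise.
δ-Spec : ℕ → ℕ → Set
δ-Spec r s =
  (δ r ((r + s) % 3) ≡ s × GapRule s r) ⊎ (δ r ((r + s) % 3) ≡ s + 3 × ¬ GapRule s r)

δ-gap : ∀ {r s} → r < 3 → s < 3 → δ-Spec r s
δ-gap r<3 s<3 = All.lookup (All.lookup table (∈-upTo⁺ r<3)) (∈-upTo⁺ s<3)
  where
  table : All (λ r → All (δ-Spec r) (upTo 3)) (upTo 3)
  table = toWitness {a? = all? (λ r → all? (λ s →
    ((δ r ((r + s) % 3) ≟ s) ×-dec gapRule? s r)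
    ⊎-dec ((δ r ((r + s) % 3) ≟ s + 3) ×-dec ¬? (gapRule? s r))) (upTo 3)) (upTo 3)} tt

gap⇒step : ∀ b g → GapRule g (b % 3) → Step 3 (b + g) b
gap⇒step b g rule = result (δ-gap (m%n<n b 3) (m%n<n g 3)) (g / 3) (m≡m%n+[m/n]*n g 3)
  where
  r = b % 3
  s = g % 3
  x = δ r ((b + g) % 3)
  δ≡ : δ r ((r + s) % 3) ≡ x
  δ≡ = cong (δ r) (sym (%-distribˡ-+ b g 3))
  step : ∀ j → g ≡ x + 3 * j → Step 3 (b + g) b
  step j g≡ = j , trans (cong (b +_) g≡) (sym (+-assoc b x (3 * j)))
  result : δ-Spec r s →
    ∀ q → g ≡ s + q * 3 → Step 3 (b + g) b
  result (inj₁ (≡s , _)) q g≡ =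
    step q (trans g≡ (cong₂ _+_ (trans (sym ≡s) δ≡) (*-comm q 3)))
  -- With `q = 0` the difference would be the forbidden `s`; otherwise one 3 is absorbed into `δ`.
  result (inj₂ (≡s+3 , ¬rule)) zero g≡ =
    contradiction (subst (λ g → GapRule g r) (trans g≡ (+-identityʳ s)) rule) ¬rule
  result (inj₂ (≡s+3 , ¬rule)) (suc q) g≡ =
    step q (trans g≡ (trans (sym (+-assoc s 3 (q * 3)))
      (cong₂ _+_ (trans (sym ≡s+3) δ≡) (*-comm q 3))))

-- Differences of at least 3 are unrestricted, so only `j = 0` with `δ` equal to `s` needs the rule
-- from the table.
step⇒gap : ∀ b g → Step 3 (b + g) b → GapRule g (b % 3)
step⇒gap b g (j , eq) = result (δ-gap (m%n<n b 3) (m%n<n g 3)) j g≡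
  where
  r = b % 3
  s = g % 3
  g≡ : g ≡ δ r ((r + s) % 3) + 3 * j
  g≡ = trans (+-cancelˡ-≡ b _ _ (trans eq (+-assoc b _ (3 * j))))
             (cong (λ t → δ r t + 3 * j) (%-distribˡ-+ b g 3))
  result : δ-Spec r s →
    ∀ j → g ≡ δ r ((r + s) % 3) + 3 * j → GapRule g r
  result (inj₁ (≡s , rule)) zero g≡ =
    subst (λ g → GapRule g r) (sym (trans g≡ (trans (+-identityʳ _) ≡s))) rule
  result (inj₁ _) (suc j) g≡ = GapRule-≥3 r
    (≤-trans (≤-trans (*-monoʳ-≤ 3 (s≤s z≤n)) (m≤n+m (3 * suc j) _)) (≤-reflexive (sym g≡)))
  result (inj₂ (≡s+3 , _)) j g≡ = GapRule-≥3 r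
    (≤-trans (≤-trans (≤-trans (m≤n+m 3 s) (≤-reflexive (sym ≡s+3))) (m≤m+n _ (3 * j)))
             (≤-reflexive (sym g≡)))

step₃⇔gap : ∀ {a b} → a ≥ b → Step 3 a b ⇔ Gap a b
step₃⇔gap {a} {b} a≥b = mk⇔
  (λ st → step⇒gap b (a ∸ b) (subst (λ x → Step 3 x b) (sym (m+[n∸m]≡n a≥b)) st))
  (λ gap → subst (λ x → Step 3 x b) (m+[n∸m]≡n a≥b) (gap⇒step b (a ∸ b) gap))

chain₃⇒gaps : ∀ {ps} → Linked _≥_ ps → Chain (Step 3) ps → Linked Gap ps
chain₃⇒gaps []      []       = []
chain₃⇒gaps [-]     (_ ∷ []) = [-]
chain₃⇒gaps (y≤x ∷ l) (s ∷ c)  = Equivalence.to (step₃⇔gap y≤x) s ∷ chain₃⇒gaps l c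

step₃-from-2 : ∀ b → Step 3 2 b → b ≡ 2
step₃-from-2 b st = cases b (step⇒≥ 3 st) st
  where
  cases : ∀ b → 2 ≥ b → Step 3 2 b → b ≡ 2
  cases 0 y≤x st = contradiction (proj₂ (Equivalence.to (step₃⇔gap y≤x) st) refl) λ ()
  cases 1 y≤x st = contradiction refl (proj₁ (Equivalence.to (step₃⇔gap y≤x) st) refl)
  cases 2 _   _  = refl
  cases (suc (suc (suc _))) (s≤s (s≤s ()))

-- A 2 can be followed only by another 2, so the last part would be 2, and the step from 2 to 0 is
-- not admissible.
chain₃⇒2∉ : ∀ {ps} → Chain (Step 3) ps → 2 ∉ ps
chain₃⇒2∉ (_ ∷ c)      (there 2∈)  = chain₃⇒2∉ c 2∈
chain₃⇒2∉ (st ∷ [])    (here refl) = contradiction (step₃-from-2 0 st) λ ()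
chain₃⇒2∉ {_ ∷ b ∷ _} (st ∷ c@(_ ∷ _)) (here refl) = chain₃⇒2∉ c (here (sym (step₃-from-2 b st)))

gaps⇒chain₃ : ∀ {ps} → Linked _≥_ ps → Linked Gap ps → 2 ∉ ps → Chain (Step 3) ps
gaps⇒chain₃ []      []      _  = []
gaps⇒chain₃ [-]     [-]     2∉ =
  -- For the step to 0, difference 1 is allowed since 0 is not 1 mod 3, and difference 2 would make
  -- the last part 2.
  Equivalence.from (step₃⇔gap z≤n) ((λ _ ()) , λ { refl → contradiction (here refl) 2∉ }) ∷ []
gaps⇒chain₃ (y≤x ∷ l) (g ∷ gs) 2∉ =
  Equivalence.from (step₃⇔gap y≤x) g ∷ gaps⇒chain₃ l gs (2∉ ∘ there)

class₂⇔chain₃ : ∀ m₁ m₂ {ps} → Partition ps → Class₂ m₁ m₂ ps ⇔ ChainClass (Step 3) m₁ m₂ ps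
class₂⇔chain₃ m₁ m₂ (isPartition _ ps↘ _) = mk⇔
  (λ (gaps , 2∉ , eqs) → gaps⇒chain₃ ps↘ gaps 2∉ , eqs)
  (λ (c , eqs) → chain₃⇒gaps ps↘ c , chain₃⇒2∉ c , eqs)

-- Chains for `d = 6` as partitions into parts 0, 1, 5 mod 6

L₆ : List ℕ
L₆ = 0 ∷ 1 ∷ 5 ∷ []

%6%3 : ∀ p → p % 6 % 3 ≡ p % 3
%6%3 p = m∣n⇒o%n%m≡o%m 3 6 p (divides 2 refl)

-- A finite check that `δ` is the difference mod 6 once residues mod 3 are lifted to 0, 1, 5.
δ-gap₆ : ∀ {r s} → r ∈ L₆ → s < 6 → (r + s) % 6 ∈ L₆ → δ (r % 3) ((r + s) % 6 % 3) ≡ s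
δ-gap₆ r∈ s<6 = All.lookup (All.lookup table r∈) (∈-upTo⁺ s<6)
  where
  table : All (λ r → All (λ s → (r + s) % 6 ∈ L₆ → δ (r % 3) ((r + s) % 6 % 3) ≡ s) (upTo 6)) L₆
  table = toWitness {a? = all? (λ r → all? (λ s →
    ((r + s) % 6 ∈? L₆) →-dec (δ (r % 3) ((r + s) % 6 % 3) ≟ s)) (upTo 6)) L₆} tt

δ-closed₆ : ∀ {r t} → r ∈ L₆ → t < 3 → (r + δ (r % 3) t) % 6 ∈ L₆
δ-closed₆ r∈ t<3 = All.lookup (All.lookup table r∈) (∈-upTo⁺ t<3)
  where
  table : All (λ r → All (λ t → (r + δ (r % 3) t) % 6 ∈ L₆) (upTo 3)) L₆
  table = toWitness {a? = all? (λ r → all? (λ t → (r + δ (r % 3) t) % 6 ∈? L₆) (upTo 3)) L₆} tt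

residues⇒step₆ : ∀ {a b} → a ≥ b → a % 6 ∈ L₆ → b % 6 ∈ L₆ → Step 6 a b
residues⇒step₆ {a} {b} a≥b a∈ b∈ = g / 6 , (begin
  a                                                ≡⟨ m+[n∸m]≡n a≥b ⟨
  b + g                                            ≡⟨ cong (b +_) (m≡m%n+[m/n]*n g 6) ⟩
  b + (g % 6 + g / 6 * 6)                          ≡⟨ cong (λ x → b + (g % 6 + x)) (*-comm (g / 6) 6) ⟩
  b + (g % 6 + 6 * (g / 6))                        ≡⟨ +-assoc b (g % 6) (6 * (g / 6)) ⟨
  b + g % 6 + 6 * (g / 6)                          ≡⟨ cong (λ x → b + x + 6 * (g / 6)) δ≡ ⟨
  b + δ (b % 3) (a % 3) + 6 * (g / 6)              ∎)
  where
  open ≡-Reasoning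
  g = a ∸ b
  a%6 : a % 6 ≡ (b % 6 + g % 6) % 6
  a%6 = trans (cong (_% 6) (sym (m+[n∸m]≡n a≥b))) (%-distribˡ-+ b g 6)
  δ≡ : δ (b % 3) (a % 3) ≡ g % 6
  δ≡ = trans (cong₂ δ (sym (%6%3 b)) (trans (sym (%6%3 a)) (cong (_% 3) a%6)))
             (δ-gap₆ b∈ (m%n<n g 6) (subst (_∈ L₆) a%6 a∈))

step₆⇒residue : ∀ a b → Step 6 a b → b % 6 ∈ L₆ → a % 6 ∈ L₆
step₆⇒residue a b (j , eq) b∈ =
  subst (_∈ L₆) (sym a%6) (δ-closed₆ b∈ (m%n<n a 3))
  where
  open ≡-Reasoning
  x = δ (b % 3) (a % 3)
  a%6 : a % 6 ≡ (b % 6 + δ (b % 6 % 3) (a % 3)) % 6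
  a%6 = begin
    a % 6                                      ≡⟨ cong (_% 6) eq ⟩
    (b + x + 6 * j) % 6                        ≡⟨ %-remove-+ʳ (b + x) (m∣m*n j) ⟩
    (b + x) % 6                                ≡⟨ %-distribˡ-+ b x 6 ⟩
    (b % 6 + x % 6) % 6                        ≡⟨ cong (λ y → (y + x % 6) % 6) (m%n%n≡m%n b 6) ⟨
    (b % 6 % 6 + x % 6) % 6                    ≡⟨ %-distribˡ-+ (b % 6) x 6 ⟨
    (b % 6 + x) % 6                            ≡⟨ cong (λ r → (b % 6 + δ r (a % 3)) % 6) (%6%3 b) ⟨
    (b % 6 + δ (b % 6 % 3) (a % 3)) % 6        ∎

residues⇒chain₆ : ∀ {ps} → Linked _≥_ ps → All (λ p → p % 6 ∈ L₆) ps → Chain (Step 6) ps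
residues⇒chain₆ []      []           = []
residues⇒chain₆ [-]     (p ∷ [])     = residues⇒step₆ z≤n p (here refl) ∷ []
residues⇒chain₆ (y≤x ∷ l) (p ∷ q ∷ qs) = residues⇒step₆ y≤x p q ∷ residues⇒chain₆ l (q ∷ qs)

-- Membership in `L₆` propagates upwards from the fictitious final part 0.
chain₆⇒residues : ∀ {ps} → Chain (Step 6) ps → All (λ p → p % 6 ∈ L₆) ps
chain₆⇒residues []                 = []
chain₆⇒residues {a ∷ []} (s ∷ []) = step₆⇒residue a 0 s (here refl) ∷ []
chain₆⇒residues {a ∷ b ∷ _} (s ∷ c@(_ ∷ _)) with q ∷ qs ← chain₆⇒residues c = step₆⇒residue a b s q ∷ q ∷ qs

filter-cong-local : ∀ {A : Set} {P Q : Pred A 0ℓ} (P? : Decidable P) (Q? : Decidable Q) {xs} →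
  All (λ x → P x ⇔ Q x) xs → filter P? xs ≡ filter Q? xs
filter-cong-local P? Q? []               = refl
filter-cong-local P? Q? {x ∷ xs} (e ∷ es) with P? x | Q? x
... | yes _ | yes _ = cong (x ∷_) (filter-cong-local P? Q? es)
... | no _  | no _  = filter-cong-local P? Q? es
... | yes p | no ¬q = contradiction (Equivalence.to e p) ¬q
... | no ¬p | yes q = contradiction (Equivalence.from e q) ¬p

-- Reduction mod 3 is injective on `L₆`, taking 1 to 1 and 5 to 2, so both statistics survive the
-- change of modulus.
numParts-6≡3 : ∀ {r t} → (∀ {x} → x ∈ L₆ → x ≡ r ⇔ x % 3 ≡ t) →
  ∀ {ps} → All (λ p → p % 6 ∈ L₆) ps → numParts r 6 ps ≡ numParts t 3 ps
numParts-6≡3 {r} {t} corr res = cong length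
  (filter-cong-local (λ p → p % 6 ≟ r) (λ p → p % 3 ≟ t)
    (All.map (λ {p} p∈ → subst (λ x → p % 6 ≡ r ⇔ x ≡ t) (%6%3 p) (corr p∈)) res))

1↔1 : ∀ {x} → x ∈ L₆ → x ≡ 1 ⇔ x % 3 ≡ 1
1↔1 (here refl)                 = mk⇔ (λ ()) (λ ())
1↔1 (there (here refl))         = mk⇔ (λ _ → refl) (λ _ → refl)
1↔1 (there (there (here refl))) = mk⇔ (λ ()) (λ ())

5↔2 : ∀ {x} → x ∈ L₆ → x ≡ 5 ⇔ x % 3 ≡ 2
5↔2 (here refl)                 = mk⇔ (λ ()) (λ ())
5↔2 (there (here refl))         = mk⇔ (λ ()) (λ ())
5↔2 (there (there (here refl))) = mk⇔ (λ _ → refl) (λ _ → refl)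

residue⇔chain₆ : ∀ m₁ m₂ {ps} → Partition ps →
  ResidueClass L₆ m₁ m₂ ps ⇔ ChainClass (Step 6) m₁ m₂ ps
residue⇔chain₆ m₁ m₂ (isPartition _ ps↘ _) = mk⇔
  (λ (res , eq₁ , eq₂) → residues⇒chain₆ ps↘ res ,
     trans (sym (numParts-6≡3 1↔1 res)) eq₁ , trans (sym (numParts-6≡3 5↔2 res)) eq₂)
  (λ (c , eq₁ , eq₂) → let res = chain₆⇒residues c in
     res , trans (numParts-6≡3 1↔1 res) eq₁ , trans (numParts-6≡3 5↔2 res) eq₂)

theorem3p3 : (n m₁ m₂ : ℕ) → C₁ m₁ m₂ n ≡ C₂ m₁ m₂ n
theorem3p3 n m₁ m₂ = begin
  C₁ m₁ m₂ n                                ≡⟨ count-splitting (class₁? m₁ m₂) units?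
                                                 (residueSplitting 3 (divides 1 refl) _ ∈0135⇔ m₁ m₂) n ⟩
  conv 3 (count units?) n (suc (n / 3))     ≡⟨ conv-cong 3 units≡minimal n (suc (n / 3)) ⟩
  conv 3 (count minimal?) n (suc (n / 3))   ≡⟨ count-splitting (class₂? m₁ m₂) minimal?
                                                 (chainSplitting 3 (divides 1 refl) m₁ m₂ (class₂⇔chain₃ m₁ m₂)) n ⟨
  C₂ m₁ m₂ n                                ∎
  where
  open ≡-Reasoning
  units?   = residueClass? (1 ∷ 5 ∷ []) m₁ m₂
  minimal? = minimalClass? m₁ m₂
  units≡minimal : ∀ n → count units? n ≡ count minimal? n
  -- Partitions into parts 0, 1, 5 mod 6 are decomposed in two ways, and the common factor P(q^6) is
  -- cancelled.
  units≡minimal = conv-injective 6 λ n → trans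
    (sym (count-splitting (residueClass? L₆ m₁ m₂) units?
      (residueSplitting 6 (divides 2 refl) L₆ ∈015⇔ m₁ m₂) n))
    (count-splitting (residueClass? L₆ m₁ m₂) minimal?
      (chainSplitting 6 (divides 2 refl) m₁ m₂ (residue⇔chain₆ m₁ m₂)) n)
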